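{- Let $G$ be a $k$-regular bipartite graph of order $m$, and let $H$ be a $2t$-regular graph of order $n$ that admits a neighborhood balanced coloring and that admits a local distance antimagic labeling. Then $\chi_{ld}((G+K_1)[H])\leq 3\,\chi_{ld}(H)$.
   Context: Graphs are finite, simple and undirected; $G$ and $H$ have no isolated vertices. For a graph $G$ of order $n$ and a bijection $f\colon V(G)\to\{1,2,\dots,n\}$, the weight of a vertex $u$ is $w_f(u)=\sum_{x\in N(u)}f(x)$, where $N(u)$ is the open neighborhood of $u$. The bijection $f$ is a local distance antimagic labeling of $G$ if $w_f(u)\neq w_f(v)$ for every edge $uv$ of $G$. The local distance antimagic chromatic number $\chi_{ld}(G)$ is the minimum number of distinct weights over all local distance antimagic labelings of $G$ (an upper bound on $\chi_{ld}$ includes the assertion that such a labeling exists). A neighborhood balanced coloring of a graph is an assignment of one of two colors to each vertex (not necessarily proper) such that every vertex has equally many neighbors of each color. $G+K_1$ is the join of $G$ with a single vertex (a new vertex adjacent to all vertices of $G$). The lexicographic product (composition) $G[H]$ has vertex set $V(G)\times V(H)$, with $(g,h)$ and $(g',h')$ adjacent iff either $gg'\in E(G)$, or $g=g'$ and $hh'\in E(H)$. -}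

module Defs where

open import Data.Bool.Base using (Bool; true; false)
open import Data.Bool.Properties using () renaming (_≟_ to _≟ᵇ_)
open import Data.Empty using (⊥)
open import Data.Fin.Base using (Fin; zero; suc; toℕ; remQuot)
open import Data.Fin.Properties using () renaming (_≟_ to _≟ᶠ_)
open import Data.List.Base using (List; allFin; deduplicate; filter; length; map; sum)
open import Data.Nat.Base using (ℕ; suc; _*_; _≤_)
open import Data.Nat.Properties using (_≟_)
open import Data.Product.Base using (_×_; _,_; ∃-syntax; Σ-syntax)
open import Data.Product.Relation.Binary.Lex.Strict using (×-Lex; ×-decidable)
open import Data.Sum.Base using (inj₁; inj₂)
open import Data.Unit.Base using (⊤; tt)
open import Function.Base using (_on_)
open import Function.Bundles using (_⤖_; Bijection)
open import Level using (0ℓ)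
open import Relation.Binary.Core using (Rel)
open import Relation.Binary.Definitions using (Decidable; Irreflexive; Symmetric)
open import Relation.Binary.PropositionalEquality using (_≡_; _≢_; refl; sym)
open import Relation.Nullary using (yes; no)

record Graph (n : ℕ) : Set₁ where
  field
    Adj         : Rel (Fin n) 0ℓ
    adj?        : Decidable Adj
    symmetric   : Symmetric Adj
    irreflexive : Irreflexive _≡_ Adj

open Graph public

private
  variable
    m n : ℕ

neighbours : Graph n → Fin n → List (Fin n)
neighbours {n} G u = filter (adj? G u) (allFin n)

degree : Graph n → Fin n → ℕ
degree G u = length (neighbours G u)

Regular : ℕ → Graph n → Set
Regular k G = ∀ u → degree G u ≡ k

NoIsolatedVertices : Graph n → Set
NoIsolatedVertices G = ∀ u → ∃[ v ] Adj G u v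

Bipartite : Graph n → Set
Bipartite {n} G = Σ[ side ∈ (Fin n → Bool) ] ∀ u v → Adj G u v → side u ≢ side v

colourDegree : Graph n → (Fin n → Bool) → Bool → Fin n → ℕ
colourDegree G c b u = length (filter (λ v → c v ≟ᵇ b) (neighbours G u))

IsNeighbourhoodBalanced : Graph n → (Fin n → Bool) → Set
IsNeighbourhoodBalanced G c = ∀ u → colourDegree G c true u ≡ colourDegree G c false u

AdmitsNeighbourhoodBalancedColouring : Graph n → Set
AdmitsNeighbourhoodBalancedColouring G = ∃[ c ] IsNeighbourhoodBalanced G c

-- A labelling takes values in {1,…,n}; the element i of Fin n stands for
-- the label 1 + toℕ i.
Labelling : ℕ → Set
Labelling n = Fin n ⤖ Fin n

label : Labelling n → Fin n → ℕ
label f v = suc (toℕ (Bijection.to f v))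

weight : Graph n → Labelling n → Fin n → ℕ
weight G f u = sum (map (label f) (neighbours G u))

IsLocalDistanceAntimagic : Graph n → Labelling n → Set
IsLocalDistanceAntimagic G f = ∀ u v → Adj G u v → weight G f u ≢ weight G f v

AdmitsLocalDistanceAntimagic : Graph n → Set
AdmitsLocalDistanceAntimagic G = ∃[ f ] IsLocalDistanceAntimagic G f

numWeights : Graph n → Labelling n → ℕ
numWeights {n} G f = length (deduplicate _≟_ (map (weight G f) (allFin n)))

-- χ_ld is a partial invariant, undefined for graphs with no local distance
-- antimagic labelling, so it is given by its graph: Isχld G c says that
-- χ_ld(G) is defined and equal to c. Such a c is unique.
record Isχld (G : Graph n) (c : ℕ) : Set where
  field
    attained : ∃[ f ] (IsLocalDistanceAntimagic G f × numWeights G f ≡ c)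
    minimal  : ∀ f → IsLocalDistanceAntimagic G f → c ≤ numWeights G f

-- The vertex zero is the added one.
_+K₁ : Graph n → Graph (suc n)
_+K₁ {n} G = record
  { Adj         = A
  ; adj?        = A?
  ; symmetric   = λ {u} {v} → A-sym u v
  ; irreflexive = λ {u} {v} → A-irrefl u v
  }
  where
  A : Rel (Fin (suc n)) 0ℓ
  A zero    zero    = ⊥
  A zero    (suc _) = ⊤
  A (suc _) zero    = ⊤
  A (suc u) (suc v) = Adj G u v

  A? : Decidable A
  A? zero    zero    = no λ ()
  A? zero    (suc _) = yes tt
  A? (suc _) zero    = yes tt
  A? (suc u) (suc v) = adj? G u v

  A-sym : ∀ u v → A u v → A v u
  A-sym zero    (suc _) _ = tt
  A-sym (suc _) zero    _ = tt
  A-sym (suc u) (suc v) e = symmetric G e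

  A-irrefl : ∀ u v → u ≡ v → A u v → ⊥
  A-irrefl (suc u) _ refl e = irreflexive G refl e

-- The lexicographic product. Its vertex set Fin m × Fin n is identified with
-- Fin (m * n) by the bijection remQuot n, whose inverse is combine. The
-- relation ×-Lex _≡_ R S relates (g , h) to (g′ , h′) when
-- R g g′ ⊎ (g ≡ g′ × S h h′).
_[_] : Graph m → Graph n → Graph (m * n)
_[_] {m} {n} G H = record
  { Adj         = A on remQuot n
  ; adj?        = λ x y → ×-decidable _≟ᶠ_ (adj? G) (adj? H) (remQuot n x) (remQuot n y)
  ; symmetric   = A-sym
  ; irreflexive = λ { refl → A-irrefl }
  }
  where
  A : Rel (Fin m × Fin n) 0ℓ
  A = ×-Lex _≡_ (Adj G) (Adj H)

  A-sym : Symmetric A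
  A-sym (inj₁ e)       = inj₁ (symmetric G e)
  A-sym (inj₂ (p , e)) = inj₂ (sym p , symmetric H e)

  A-irrefl : ∀ {x} → A x x → ⊥
  A-irrefl (inj₁ e)       = irreflexive G refl e
  A-irrefl (inj₂ (_ , e)) = irreflexive H refl e

{-# OPTIONS --safe #-}
-- Let a be the number of copies of H in a class of copies. A class receives
-- consecutive labels o + 1, …, o + a n, and its q-th copy gives to the vertex h
-- the label o + a (f h − 1) + q or o + a (f h − 1) + (a + 1 − q), according to
-- the colour of h. Every vertex of H sees t vertices of each colour, and the
-- two colours are equally frequent in H (double counting), so neither the
-- weight inside a copy nor the total S of a copy depends on q: the weight
-- inside is an increasing affine function of the weight under f, and the weight
-- of (g , h) depends only on the class of g and the weight of h. With the added
-- vertex and the two sides of G as the three classes, there are at most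
-- 3 χ_ld(H) weights.
--
-- Adjacent vertices in different classes are separated by comparing
-- complements. If all labels of the class of u are below those of the class of
-- v, then S_u minus any inner weight in copy u is less than S_v minus any inner
-- weight in copy v, because H is regular and every vertex is a nonneighbour of
-- itself. Hence the weights in copy u exceed those in copy v as soon as the sum
-- of S over the closed neighbourhood of u is at least that of v. This holds
-- when the added vertex comes first, and between the two sides of G because
-- k ≥ 1.

module Submission where

open import Defs
open import Data.Bool.Base using (Bool; true; false; not; if_then_else_)
open import Data.Bool.Properties using (¬-not) renaming (_≟_ to _≟ᵇ_)
open import Data.Empty using (⊥-elim)
open import Data.Fin.Base as Fin
  using (Fin; zero; suc; toℕ; combine; remQuot; splitAt; _↑ˡ_; _↑ʳ_; opposite; punchOut;
    finToFun; funToFin; cast)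
open import Data.Fin.Patterns using (0F; 1F; 2F)
open import Data.Fin.Properties
  using (any?; all?; toℕ-injective; toℕ<n; toℕ-cast; toℕ-combine; combine-injective;
    remQuot-combine; combine-remQuot; splitAt-↑ˡ; splitAt-↑ʳ; toℕ-↑ˡ; toℕ-↑ʳ; opposite-prop;
    opposite-involutive; punchOut-injective; <⇒notInjective; injective⇒≤; nonZeroIndex;
    finToFun-funToFin) renaming (_≟_ to _≟ᶠ_; <-cmp to <-cmpᶠ)
open import Data.List.Base as List
  using (List; []; _∷_; allFin; tabulate; filter; length; map; deduplicate;
    cartesianProductWith)
open import Data.List.Membership.Propositional using (_∈_)
open import Data.List.Membership.Propositional.Properties
  using (∈-lookup; ∈-map⁺; ∈-map⁻; ∈-allFin; ∈-deduplicate⁺; ∈-deduplicate⁻;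
    ∈-cartesianProductWith⁺)
open import Data.List.Membership.Setoid.Properties using (index-injective)
open import Data.List.Properties
  using (map-tabulate; map-cong; length-tabulate; length-++; length-map)
open import Data.List.Relation.Binary.Subset.Propositional using (_⊆_)
import Data.List.Relation.Unary.All as All
import Data.List.Relation.Unary.Any as Any
open import Data.List.Relation.Unary.AllPairs using (_∷_)
open import Data.List.Relation.Unary.Unique.Propositional using (Unique)
open import Data.List.Relation.Unary.Unique.DecPropositional.Properties using (deduplicate-!)
open import Data.Nat.Base
  using (ℕ; zero; suc; _+_; _*_; _∸_; _≤_; _<_; z≤n; s≤s; ≢-nonZero; >-nonZero)
open import Data.Nat.Induction using (<-wellFounded)
open import Data.Nat.ListAction using () renaming (sum to sumᴸ)
open import Data.Nat.Properties
open import Data.Nat.Tactic.RingSolver using (solve-∀)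
open import Data.Product.Base using (_×_; _,_; proj₁; proj₂; ∃-syntax; Σ-syntax; uncurry)
open import Data.Product.Properties using (,-injectiveˡ)
open import Data.Product.Properties.WithK using (,-injectiveʳ)
open import Data.Product.Relation.Binary.Lex.Strict using (×-Lex; ×-decidable)
open import Data.Sum.Base using (inj₁; inj₂; [_,_]′)
open import Function.Base using (_∘_; const; id; _∋_)
open import Function.Bundles using (mk⤖; Bijection)
open import Function.Definitions using (Injective; Surjective)
open import Induction.WellFounded using (Acc; acc)
open import Relation.Binary.Definitions using (tri<; tri≈; tri>)
open import Relation.Binary.PropositionalEquality hiding ([_])
open import Relation.Nullary using (Dec; yes; no; does; ¬_; contradiction)
open import Relation.Nullary.Decidable using (¬?; _→-dec_; _×-dec_; map′; dec-true; dec-false)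
open import Relation.Unary using (Pred; Decidable)

open import Algebra.Properties.Semiring.Sum +-*-semiring
  using (sum; sum-cong-≗; *-distribˡ-sum; *-distribʳ-sum; ∑-distrib-+; ∑-comm)

private
  variable
    m n r : ℕ
    A : Set

-- Finite sums

sum-mono-≤ : {f g : Fin n → ℕ} → (∀ i → f i ≤ g i) → sum f ≤ sum g
sum-mono-≤ {zero}  f≤g = z≤n
sum-mono-≤ {suc n} f≤g = +-mono-≤ (f≤g zero) (sum-mono-≤ (f≤g ∘ suc))

term≤sum : ∀ (Y : Fin n → ℕ) i → Y i ≤ sum Y
term≤sum Y zero    = m≤m+n (Y zero) _
term≤sum Y (suc i) = ≤-trans (term≤sum (Y ∘ suc) i) (m≤n+m _ (Y zero))

sum-++ : ∀ m {n} (F : Fin (m + n) → ℕ) → sum F ≡ sum (λ i → F (i ↑ˡ n)) + sum (λ j → F (m ↑ʳ j))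
sum-++ zero    F = refl
sum-++ (suc m) F = trans (cong (F zero +_) (sum-++ m (F ∘ suc))) (sym (+-assoc (F zero) _ _))

sum-combine : ∀ (F : Fin (m * n) → ℕ) → sum F ≡ sum (λ i → sum (λ j → F (combine {m} i j)))
sum-combine {zero}          F = refl
sum-combine {suc m} {n} F =
  trans (sum-++ n F) (cong (sum (λ j → F (j ↑ˡ (m * n))) +_) (sum-combine {m} (F ∘ (n ↑ʳ_))))

sum-constant : ∀ n x → sum {n} (λ _ → x) ≡ n * x
sum-constant zero    x = refl
sum-constant (suc n) x = cong (x +_) (sum-constant n x)

𝟙 : ∀ {P : Set} → Dec P → ℕ
𝟙 p? = if does p? then 1 else 0

𝟙-true : ∀ {P : Set} (p? : Dec P) → P → 𝟙 p? ≡ 1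
𝟙-true p? p rewrite dec-true p? p = refl

𝟙-false : ∀ {P : Set} (p? : Dec P) → ¬ P → 𝟙 p? ≡ 0
𝟙-false p? ¬p rewrite dec-false p? ¬p = refl

sum-δ : ∀ (g : Fin n) (Y : Fin n → ℕ) → sum (λ i → 𝟙 (g ≟ᶠ i) * Y i) ≡ Y g
sum-δ {suc n} zero Y = begin
  1 * Y zero + sum {n} (λ _ → 0)  ≡⟨ cong₂ _+_ (*-identityˡ _) (sum-constant n 0) ⟩
  Y zero + n * 0                  ≡⟨ cong (Y zero +_) (*-zeroʳ n) ⟩
  Y zero + 0                      ≡⟨ +-identityʳ _ ⟩
  Y zero                          ∎
  where open ≡-Reasoning
-- The head term reduces to `0`, and the indicator at `suc g` and `suc i` reduces to the one at `g`
-- and `i`, so the recursive call has the required type definitionally.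
sum-δ (suc g) Y = sum-δ g (Y ∘ suc)

sum-filter : ∀ {P : Pred A _} (P? : Decidable P) (g : A → ℕ) xs →
  sumᴸ (map g (filter P? xs)) ≡ sumᴸ (map (λ x → 𝟙 (P? x) * g x) xs)
sum-filter P? g []       = refl
sum-filter P? g (x ∷ xs) with P? x
... | yes _ = cong₂ _+_ (sym (*-identityˡ (g x))) (sum-filter P? g xs)
... | no  _ = sum-filter P? g xs

sum-tabulate : ∀ (g : Fin n → ℕ) → sumᴸ (tabulate g) ≡ sum g
sum-tabulate {zero}  g = refl
sum-tabulate {suc n} g = cong (g zero +_) (sum-tabulate (g ∘ suc))

sum-allFin : ∀ (g : Fin n → ℕ) → sumᴸ (map g (allFin n)) ≡ sum g
sum-allFin g = trans (cong sumᴸ (map-tabulate id g)) (sum-tabulate g)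

length-as-sum : ∀ (xs : List A) → length xs ≡ sumᴸ (map (const 1) xs)
length-as-sum []       = refl
length-as-sum (x ∷ xs) = cong suc (length-as-sum xs)

-- Degrees and neighbour sums through adjacency indicators

module _ (G : Graph n) where

  adj : Fin n → Fin n → ℕ
  adj u v = 𝟙 (adj? G u v)

  sum-neighbours : ∀ u (g : Fin n → ℕ) → sumᴸ (map g (neighbours G u)) ≡ sum (λ v → adj u v * g v)
  sum-neighbours u g = trans (sum-filter (adj? G u) g (allFin n)) (sum-allFin (λ v → adj u v * g v))

  degree-sum : ∀ u → degree G u ≡ sum (adj u)
  degree-sum u = begin
    degree G u                             ≡⟨ length-as-sum (neighbours G u) ⟩
    sumᴸ (map (const 1) (neighbours G u))  ≡⟨ sum-neighbours u (const 1) ⟩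
    sum (λ v → adj u v * 1)                ≡⟨ sum-cong-≗ (λ v → *-identityʳ (adj u v)) ⟩
    sum (adj u)                            ∎
    where open ≡-Reasoning

  colourDegree-sum : ∀ c b u → colourDegree G c b u ≡ sum (λ v → adj u v * 𝟙 (c v ≟ᵇ b))
  colourDegree-sum c b u = begin
    colourDegree G c b u
      ≡⟨ length-as-sum (filter (λ v → c v ≟ᵇ b) (neighbours G u)) ⟩
    sumᴸ (map (const 1) (filter (λ v → c v ≟ᵇ b) (neighbours G u)))
      ≡⟨ sum-filter (λ v → c v ≟ᵇ b) (const 1) (neighbours G u) ⟩
    sumᴸ (map (λ v → 𝟙 (c v ≟ᵇ b) * 1) (neighbours G u))
      ≡⟨ sum-neighbours u (λ v → 𝟙 (c v ≟ᵇ b) * 1) ⟩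
    sum (λ v → adj u v * (𝟙 (c v ≟ᵇ b) * 1))
      ≡⟨ sum-cong-≗ (λ v → cong (adj u v *_) (*-identityʳ _)) ⟩
    sum (λ v → adj u v * 𝟙 (c v ≟ᵇ b))
      ∎
    where open ≡-Reasoning

  adj-sym : ∀ u v → adj u v ≡ adj v u
  adj-sym u v with adj? G u v
  ... | yes e = sym (𝟙-true (adj? G v u) (symmetric G e))
  ... | no ¬e = sym (𝟙-false (adj? G v u) (¬e ∘ symmetric G))

  -- Double counting: after exchanging the sums, `Y v` is counted once for each neighbour of `v`,
  -- hence `d` times.
  handshake : ∀ {d} → Regular d G → ∀ (Y : Fin n → ℕ) →
    sum (λ u → sum (λ v → adj u v * Y v)) ≡ d * sum Y
  handshake {d} reg Y = begin
    sum (λ u → sum (λ v → adj u v * Y v))  ≡⟨ ∑-comm (λ u v → adj u v * Y v) ⟩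
    sum (λ v → sum (λ u → adj u v * Y v))  ≡⟨ sum-cong-≗ (λ v → sym (*-distribʳ-sum (Y v) (λ u → adj u v))) ⟩
    sum (λ v → sum (λ u → adj u v) * Y v)  ≡⟨ sum-cong-≗ (λ v → cong (_* Y v) (sum-cong-≗ (λ u → adj-sym u v))) ⟩
    sum (λ v → sum (adj v) * Y v)          ≡⟨ sum-cong-≗ (λ v → cong (_* Y v) (trans (sym (degree-sum v)) (reg v))) ⟩
    sum (λ v → d * Y v)                    ≡⟨ *-distribˡ-sum d Y ⟨
    d * sum Y                              ∎
    where open ≡-Reasoning

-- Counting values, and existence of χ_ld

-- Pigeonhole: if `y` were missed, punching it out would leave an injection from `Fin (suc n)` into
-- `Fin n`.
injective⇒surjective : ∀ {f : Fin n → Fin n} → Injective _≡_ _≡_ f → Surjective _≡_ _≡_ f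
injective⇒surjective {suc n} {f} inj y with any? (λ x → f x ≟ᶠ y)
... | yes (x , fx≡y) = x , λ { refl → fx≡y }
... | no ¬∃ = contradiction
  (λ {i} {j} eq → inj (punchOut-injective (¬∃ ∘ (i ,_) ∘ sym) (¬∃ ∘ (j ,_) ∘ sym) eq))
  (<⇒notInjective {f = λ x → punchOut (¬∃ ∘ (x ,_) ∘ sym)} (n<1+n n))

labelling : (f : Fin n → Fin n) → Injective _≡_ _≡_ f → Labelling n
labelling f inj = mk⤖ (inj , injective⇒surjective inj)

lookup-unique : ∀ {xs : List A} → Unique xs → ∀ i j → List.lookup xs i ≡ List.lookup xs j → i ≡ j
lookup-unique (x∉ ∷ xs!) zero    zero    eq = refl
lookup-unique (x∉ ∷ xs!) zero    (suc j) eq = contradiction eq (All.lookup x∉ (∈-lookup j))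
lookup-unique (x∉ ∷ xs!) (suc i) zero    eq = contradiction (sym eq) (All.lookup x∉ (∈-lookup i))
lookup-unique (x∉ ∷ xs!) (suc i) (suc j) eq = cong suc (lookup-unique xs! i j eq)

-- Sending each position of `xs` to the place of its entry in `ys` is injective, because the entries
-- of `xs` are distinct.
length-mono-⊆ : ∀ {xs ys : List A} → Unique xs → xs ⊆ ys → length xs ≤ length ys
length-mono-⊆ xs! xs⊆ys = injective⇒≤ {f = λ i → Any.index (xs⊆ys (∈-lookup i))}
  (λ {i} {j} eq → lookup-unique xs! i j
    (index-injective (setoid _) (xs⊆ys (∈-lookup i)) (xs⊆ys (∈-lookup j)) eq))

length-cartesianProductWith : ∀ {B C : Set} (f : A → B → C) xs ys →
  length (cartesianProductWith f xs ys) ≡ length xs * length ys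
length-cartesianProductWith f []       ys = refl
length-cartesianProductWith f (x ∷ xs) ys =
  trans (length-++ (map (f x) ys)) (cong₂ _+_ (length-map (f x) ys) (length-cartesianProductWith f xs ys))

∣image_∣ : (Fin n → ℕ) → ℕ
∣image_∣ {n} W = length (deduplicate _≟_ (map W (allFin n)))

-- All values of `W` occur in the table of `Φ κ y`, with `κ` a class and `y` a value of `w`. With
-- three classes this gives the factor 3 of the theorem.
image-bound : ∀ (Φ : Fin r → ℕ → ℕ) (W : Fin m → ℕ) (w : Fin n → ℕ) →
  (∀ x → ∃[ κ ] ∃[ h ] W x ≡ Φ κ (w h)) → ∣image W ∣ ≤ r * ∣image w ∣
image-bound {r} {m} {n} Φ W w W≡Φw =
  subst (∣image W ∣ ≤_)
    (trans (length-cartesianProductWith Φ (allFin r) ws) (cong (_* ∣image w ∣) (length-tabulate {n = r} id)))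
    (length-mono-⊆ (deduplicate-! _≟_ (map W (allFin m))) incl)
  where
  ws = deduplicate _≟_ (map w (allFin n))

  incl : deduplicate _≟_ (map W (allFin m)) ⊆ cartesianProductWith Φ (allFin r) ws
  incl y∈ with ∈-map⁻ W (∈-deduplicate⁻ _≟_ (map W (allFin m)) y∈)
  ... | x , _ , refl with W≡Φw x
  ... | κ , h , eq = subst (_∈ cartesianProductWith Φ (allFin r) ws) (sym eq)
    (∈-cartesianProductWith⁺ Φ (∈-allFin κ) (∈-deduplicate⁺ _≟_ (∈-map⁺ w (∈-allFin h))))

module _ (G : Graph n) where

  weightOf : (Fin n → Fin n) → Fin n → ℕ
  weightOf g u = sumᴸ (map (suc ∘ toℕ ∘ g) (neighbours G u))

  weightOf-cong : ∀ {g g′} → g ≗ g′ → weightOf g ≗ weightOf g′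
  weightOf-cong g≗g′ u = cong sumᴸ (map-cong (cong (suc ∘ toℕ) ∘ g≗g′) (neighbours G u))

  -- Stated for bare functions, which form a finite searchable set. Injectivity is enough, since an
  -- injection of `Fin n` into itself is a bijection.
  AntimagicBelow : ℕ → (Fin n → Fin n) → Set
  AntimagicBelow c g =
    (∀ x y → g x ≡ g y → x ≡ y) ×
    (∀ u v → Adj G u v → weightOf g u ≢ weightOf g v) ×
    ∣image weightOf g ∣ < c

  antimagicBelow? : ∀ c → Decidable (AntimagicBelow c)
  antimagicBelow? c g =
    all? (λ x → all? λ y → (g x ≟ᶠ g y) →-dec (x ≟ᶠ y)) ×-dec
    all? (λ u → all? λ v → adj? G u v →-dec ¬? (weightOf g u ≟ weightOf g v)) ×-dec
    (∣image weightOf g ∣ <? c)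

  -- Decoding the code of a function gives it back only up to pointwise equality, so the search
  -- needs a property that respects `≗`.
  antimagicBelow-resp : ∀ {c g g′} → g ≗ g′ → AntimagicBelow c g → AntimagicBelow c g′
  antimagicBelow-resp {c} {g} {g′} g≗g′ (inj , anti , below) =
    (λ x y eq → inj x y (trans (g≗g′ x) (trans eq (sym (g≗g′ y))))) ,
    (λ u v e eq → anti u v e (trans (w≗ u) (trans eq (sym (w≗ v))))) ,
    subst (_< c) (cong (length ∘ deduplicate _≟_) (map-cong w≗ (allFin n))) below
    where
    w≗ = weightOf-cong g≗g′

  -- Exhaustive search over the codes in `Fin (n ^ n)` of all functions from `Fin n` to itself.
  fewerWeights? : ∀ c → Dec (∃[ f ] (IsLocalDistanceAntimagic G f × numWeights G f < c))
  fewerWeights? c = map′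
    (λ { (i , inj , anti , below) → labelling (finToFun i) (λ {x} {y} → inj x y) , anti , below })
    (λ { (f , anti , below) → funToFin (Bijection.to f) ,
         antimagicBelow-resp (sym ∘ finToFun-funToFin (Bijection.to f))
           ((λ x y → Bijection.injective f) , anti , below) })
    (any? (antimagicBelow? c ∘ finToFun))

  -- Replace the labelling by one with fewer weights as long as the search finds one. The number of
  -- weights decreases, so this stops, and it stops at a minimum.
  χld-upper-bound : ∀ f → IsLocalDistanceAntimagic G f → ∃[ c ] (Isχld G c × c ≤ numWeights G f)
  χld-upper-bound f anti = descend f anti (<-wellFounded _)
    where
    descend : ∀ f → IsLocalDistanceAntimagic G f → Acc _<_ (numWeights G f) →
      ∃[ c ] (Isχld G c × c ≤ numWeights G f)
    descend f anti (acc rec) with fewerWeights? (numWeights G f)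
    ... | no ¬fewer = numWeights G f ,
      record { attained = f , anti , refl ; minimal = λ f′ anti′ → ≮⇒≥ (λ fewer → ¬fewer (f′ , anti′ , fewer)) } ,
      ≤-refl
    ... | yes (f′ , anti′ , fewer) with descend f′ anti′ (rec fewer)
    ...   | c , isχ , c≤ = c , isχ , ≤-trans c≤ (<⇒≤ fewer)

-- The lexicographic product

module _ (Γ : Graph m) (H : Graph n) where

  -- The two alternatives of the lexicographic relation exclude each other, as `Γ` is irreflexive,
  -- so their indicators add.
  adj-[] : ∀ g h g′ h′ → adj (Γ [ H ]) (combine g h) (combine g′ h′) ≡
                         adj Γ g g′ + 𝟙 (g ≟ᶠ g′) * adj H h h′
  adj-[] g h g′ h′ = trans
    (cong₂ (λ x y → 𝟙 (×-decidable _≟ᶠ_ (adj? Γ) (adj? H) x y)) (remQuot-combine g h) (remQuot-combine g′ h′))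
    cases
    where
    cases : 𝟙 (×-decidable _≟ᶠ_ (adj? Γ) (adj? H) (g , h) (g′ , h′)) ≡ adj Γ g g′ + 𝟙 (g ≟ᶠ g′) * adj H h h′
    cases with adj? Γ g g′ | g ≟ᶠ g′ | adj? H h h′
    ... | yes e | yes refl | _     = ⊥-elim (irreflexive Γ refl e)
    ... | yes _ | no  _    | _     = refl
    ... | no  _ | yes _    | yes _ = refl
    ... | no  _ | yes _    | no  _ = refl
    ... | no  _ | no  _    | _     = refl

  -- A copy adjacent to copy `g` is joined to it completely and enters with its whole label sum,
  -- whatever `h` is. The indicator of `g ≟ᶠ g′` singles out the copy of `g` itself.
  weight-[] : (F : Labelling (m * n)) (L : Fin m → Fin n → ℕ) →
    (∀ g h → label F (combine g h) ≡ L g h) → ∀ g h →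
    weight (Γ [ H ]) F (combine g h) ≡
      sum (λ h′ → adj H h h′ * L g h′) + sum (λ g′ → adj Γ g g′ * sum (L g′))
  weight-[] F L F≡L g h = begin
    weight (Γ [ H ]) F (combine g h)
      ≡⟨ sum-neighbours (Γ [ H ]) (combine g h) (label F) ⟩
    sum (λ x → adj (Γ [ H ]) (combine g h) x * label F x)
      ≡⟨ sum-combine {m} {n} (λ x → adj (Γ [ H ]) (combine g h) x * label F x) ⟩
    sum {m} (λ g′ → sum {n} (λ h′ → adj (Γ [ H ]) (combine g h) (combine g′ h′) * label F (combine g′ h′)))
      ≡⟨ sum-cong-≗ (λ g′ → sum-cong-≗ (λ h′ → pointwise g′ h′)) ⟩
    sum (λ g′ → sum (λ h′ → 𝟙 (g ≟ᶠ g′) * (adj H h h′ * L g′ h′) + adj Γ g g′ * L g′ h′))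
      ≡⟨ sum-cong-≗ (λ g′ → ∑-distrib-+ (λ h′ → 𝟙 (g ≟ᶠ g′) * (adj H h h′ * L g′ h′)) (λ h′ → adj Γ g g′ * L g′ h′)) ⟩
    sum (λ g′ → sum (λ h′ → 𝟙 (g ≟ᶠ g′) * (adj H h h′ * L g′ h′)) + sum (λ h′ → adj Γ g g′ * L g′ h′))
      ≡⟨ sum-cong-≗ (λ g′ → cong₂ _+_ (*-distribˡ-sum (𝟙 (g ≟ᶠ g′)) (λ h′ → adj H h h′ * L g′ h′))
                                      (*-distribˡ-sum (adj Γ g g′) (L g′))) ⟨
    sum (λ g′ → 𝟙 (g ≟ᶠ g′) * X g′ + adj Γ g g′ * sum (L g′))
      ≡⟨ ∑-distrib-+ (λ g′ → 𝟙 (g ≟ᶠ g′) * X g′) (λ g′ → adj Γ g g′ * sum (L g′)) ⟩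
    sum (λ g′ → 𝟙 (g ≟ᶠ g′) * X g′) + sum (λ g′ → adj Γ g g′ * sum (L g′))
      ≡⟨ cong (_+ sum (λ g′ → adj Γ g g′ * sum (L g′))) (sum-δ g X) ⟩
    X g + sum (λ g′ → adj Γ g g′ * sum (L g′))
      ∎
    where
    open ≡-Reasoning
    X : Fin m → ℕ
    X g′ = sum (λ h′ → adj H h h′ * L g′ h′)

    rearrange : ∀ a δ b l → (a + δ * b) * l ≡ δ * (b * l) + a * l
    rearrange = solve-∀

    pointwise : ∀ g′ h′ → adj (Γ [ H ]) (combine g h) (combine g′ h′) * label F (combine g′ h′) ≡
                          𝟙 (g ≟ᶠ g′) * (adj H h h′ * L g′ h′) + adj Γ g g′ * L g′ h′
    pointwise g′ h′ = trans (cong₂ _*_ (adj-[] g h g′ h′) (F≡L g′ h′))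
                            (rearrange (adj Γ g g′) (𝟙 (g ≟ᶠ g′)) (adj H h h′) (L g′ h′))

-- Labelling the copies of H by classes

glue : (s : Fin r → ℕ) (b : Fin r) → Fin (s b) → Fin (sum s)
glue {suc r} s zero    i = i ↑ˡ sum (s ∘ suc)
glue {suc r} s (suc b) i = s zero ↑ʳ glue (s ∘ suc) b i

unglue : (s : Fin r → ℕ) → Fin (sum s) → Σ[ b ∈ Fin r ] Fin (s b)
unglue {suc r} s x = [ zero ,_ , (λ y → let b , i = unglue (s ∘ suc) y in suc b , i) ]′ (splitAt (s zero) x)

unglue-glue : ∀ (s : Fin r → ℕ) b i → unglue s (glue s b i) ≡ (b , i)
unglue-glue {suc r} s zero    i rewrite splitAt-↑ˡ (s zero) i (sum (s ∘ suc)) = refl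
unglue-glue {suc r} s (suc b) i rewrite splitAt-↑ʳ (s zero) (sum (s ∘ suc)) (glue (s ∘ suc) b i)
                                      | unglue-glue (s ∘ suc) b i = refl

offset : (Fin r → ℕ) → Fin r → ℕ
offset s zero    = 0
offset s (suc b) = s zero + offset (s ∘ suc) b

toℕ-glue : ∀ (s : Fin r → ℕ) b i → toℕ (glue s b i) ≡ offset s b + toℕ i
toℕ-glue {suc r} s zero    i = toℕ-↑ˡ i (sum (s ∘ suc))
toℕ-glue {suc r} s (suc b) i = begin
  toℕ (s zero ↑ʳ glue (s ∘ suc) b i)          ≡⟨ toℕ-↑ʳ (s zero) (glue (s ∘ suc) b i) ⟩
  s zero + toℕ (glue (s ∘ suc) b i)           ≡⟨ cong (s zero +_) (toℕ-glue (s ∘ suc) b i) ⟩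
  s zero + (offset (s ∘ suc) b + toℕ i)       ≡⟨ +-assoc (s zero) _ _ ⟨
  s zero + offset (s ∘ suc) b + toℕ i         ∎
  where open ≡-Reasoning

offset-mono : ∀ (s : Fin r → ℕ) {b b′} → b Fin.< b′ → offset s b + s b ≤ offset s b′
offset-mono s {zero}  {suc b′} _         = m≤m+n (s zero) _
offset-mono s {suc b} {suc b′} (s≤s b<b′) =
  ≤-trans (≤-reflexive (+-assoc (s zero) _ _)) (+-monoʳ-≤ (s zero) (offset-mono (s ∘ suc) b<b′))

classSize : (Fin m → Fin r) → Fin r → ℕ
classSize κ b = sum (λ i → 𝟙 (κ i ≟ᶠ b))

sum-classSize : ∀ (κ : Fin m → Fin r) → sum (classSize κ) ≡ m
sum-classSize {m} κ = begin
  sum (λ b → sum (λ i → 𝟙 (κ i ≟ᶠ b)))      ≡⟨ ∑-comm (λ b i → 𝟙 (κ i ≟ᶠ b)) ⟩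
  sum (λ i → sum (λ b → 𝟙 (κ i ≟ᶠ b)))      ≡⟨ sum-cong-≗ (λ i → sum-cong-≗ (λ b → *-identityʳ (𝟙 (κ i ≟ᶠ b)))) ⟨
  sum (λ i → sum (λ b → 𝟙 (κ i ≟ᶠ b) * 1))  ≡⟨ sum-cong-≗ (λ i → sum-δ (κ i) (const 1)) ⟩
  sum {m} (λ i → 1)                         ≡⟨ sum-constant m 1 ⟩
  m * 1                                     ≡⟨ *-identityʳ m ⟩
  m                                         ∎
  where open ≡-Reasoning

-- The number of smaller indices in the same class: index `zero` shifts all later ranks by the
-- indicator that it shares their class. The `cast` turns `Fin 1` into the `Fin` of that indicator
-- for `zero` itself.
rank : (κ : Fin m → Fin r) (i : Fin m) → Fin (classSize κ (κ i))
rank κ zero    = cast (sym (𝟙-true (κ zero ≟ᶠ κ zero) refl)) 0F ↑ˡ classSize (κ ∘ suc) (κ zero)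
rank κ (suc i) = 𝟙 (κ zero ≟ᶠ κ (suc i)) ↑ʳ rank (κ ∘ suc) i

unrank : (κ : Fin m → Fin r) (b : Fin r) → Fin (classSize κ b) → Fin m
unrank {suc m} κ b q = [ const zero , suc ∘ unrank (κ ∘ suc) b ]′ (splitAt (𝟙 (κ zero ≟ᶠ b)) q)

unrank-rank : ∀ (κ : Fin m → Fin r) i → unrank κ (κ i) (rank κ i) ≡ i
unrank-rank κ zero
  rewrite splitAt-↑ˡ (𝟙 (κ zero ≟ᶠ κ zero)) (cast (sym (𝟙-true (κ zero ≟ᶠ κ zero) refl)) 0F) (classSize (κ ∘ suc) (κ zero)) = refl
unrank-rank κ (suc i)
  rewrite splitAt-↑ʳ (𝟙 (κ zero ≟ᶠ κ (suc i))) (classSize (κ ∘ suc) (κ (suc i))) (rank (κ ∘ suc) i) =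
  cong suc (unrank-rank (κ ∘ suc) i)

rank-injective : ∀ (κ : Fin m → Fin r) {i j} →
  (Σ[ b ∈ Fin r ] Fin (classSize κ b) ∋ (κ i , rank κ i)) ≡ (κ j , rank κ j) → i ≡ j
rank-injective κ {i} {j} eq =
  trans (sym (unrank-rank κ i)) (trans (cong (uncurry (unrank κ)) eq) (unrank-rank κ j))

suc-toℕ-opposite : ∀ (q : Fin n) → suc (toℕ (opposite q)) ≡ n ∸ toℕ q
suc-toℕ-opposite {n} q = begin
  suc (toℕ (opposite q))  ≡⟨ cong suc (opposite-prop q) ⟩
  suc (n ∸ suc (toℕ q))   ≡⟨ +-∸-assoc 1 (toℕ<n q) ⟨
  n ∸ toℕ q               ∎
  where open ≡-Reasoning

-- Count adjacent pairs whose second vertex has a given colour. This gives `d` times the size of the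
-- colour class, and balance makes the two counts equal.
colour-classes-equal : ∀ (H : Graph n) {d} → NoIsolatedVertices H → Regular d H →
  ∀ c → IsNeighbourhoodBalanced H c →
  sum (λ h → 𝟙 (c h ≟ᵇ true)) ≡ sum (λ h → 𝟙 (c h ≟ᵇ false))
colour-classes-equal {zero}  H     ¬iso reg c bal = refl
colour-classes-equal {suc n} H {d} ¬iso reg c bal = *-cancelˡ-≡ _ _ d {{≢-nonZero d≢0}} (begin
  d * sum (λ h → 𝟙 (c h ≟ᵇ true))                     ≡⟨ handshake H reg (λ h → 𝟙 (c h ≟ᵇ true)) ⟨
  sum (λ u → sum (λ v → adj H u v * 𝟙 (c v ≟ᵇ true)))  ≡⟨ sum-cong-≗ (λ u → colourDegree-sum H c true u) ⟨
  sum (colourDegree H c true)                         ≡⟨ sum-cong-≗ bal ⟩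
  sum (colourDegree H c false)                        ≡⟨ sum-cong-≗ (λ u → colourDegree-sum H c false u) ⟩
  sum (λ u → sum (λ v → adj H u v * 𝟙 (c v ≟ᵇ false))) ≡⟨ handshake H reg (λ h → 𝟙 (c h ≟ᵇ false)) ⟩
  d * sum (λ h → 𝟙 (c h ≟ᵇ false))                    ∎)
  where
  open ≡-Reasoning
  -- The edge at `zero` forces positive degree, so `d` can be cancelled.
  d≢0 : d ≢ 0
  d≢0 refl with ¬iso zero
  ... | v , e = contradiction (subst (_≤ 0) (𝟙-true (adj? H zero v) e)
    (subst (adj H zero v ≤_) (trans (sym (degree-sum H zero)) (reg zero)) (term≤sum (adj H zero) v))) λ ()

module Blocks (f : Labelling n) (c : Fin n → Bool) (κ : Fin m → Fin r) where

  -- An array in row-major order, with a row of length `s` for each label of `f`. Rows of one colour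
  -- are filled forwards and the others backwards, so `q` and `opposite q` add up to `s − 1` in
  -- every copy.
  cell : ∀ {s} → Fin n → Fin s → Fin (n * s)
  cell h q = combine (Bijection.to f h) (if c h then q else opposite q)

  cell-injective : ∀ {s} {h h′} {q q′ : Fin s} → cell h q ≡ cell h′ q′ → h ≡ h′ × q ≡ q′
  cell-injective {s} {h} {h′} {q} {q′} eq
    with combine-injective (Bijection.to f h) _ (Bijection.to f h′) _ eq
  ... | eq₁ , eq₂ with Bijection.injective f eq₁
  ... | refl = refl , position (c h) eq₂
    where
    position : ∀ b → (if b then q else opposite q) ≡ (if b then q′ else opposite q′) → q ≡ q′
    position true  eq = eq
    position false eq = trans (sym (opposite-involutive q)) (trans (cong opposite eq) (opposite-involutive q′))

  blockSize : Fin r → ℕ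
  blockSize b = n * classSize κ b

  start : Fin r → ℕ
  start = offset blockSize

  copyLabel : Fin m → Fin n → ℕ
  copyLabel g h = suc (start (κ g) + toℕ (cell h (rank κ g)))

  -- The block of an earlier class ends before `start b`. With `copyLabel>`, this makes `start b` a
  -- threshold between the labels of two classes.
  copyLabel≤ : ∀ {g} {b} → κ g Fin.< b → ∀ h → copyLabel g h ≤ start b
  copyLabel≤ {g} κg<b h =
    ≤-trans (+-monoʳ-< (start (κ g)) (toℕ<n (cell h (rank κ g)))) (offset-mono blockSize κg<b)

  copyLabel> : ∀ g h → start (κ g) < copyLabel g h
  copyLabel> g h = s≤s (m≤m+n (start (κ g)) _)

  slot : Fin m × Fin n → Fin (sum blockSize)
  slot (g , h) = glue blockSize (κ g) (cell h (rank κ g))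

  slot-injective : ∀ {x y} → slot x ≡ slot y → x ≡ y
  slot-injective {g , h} {g′ , h′} eq with split-cell (rank κ g) (rank κ g′) pair
    where
    pair : (Σ[ b ∈ Fin r ] Fin (blockSize b) ∋ (κ g , cell h (rank κ g))) ≡ (κ g′ , cell h′ (rank κ g′))
    pair = trans (sym (unglue-glue blockSize (κ g) _))
                 (trans (cong (unglue blockSize) eq) (unglue-glue blockSize (κ g′) _))
    -- The classes are generalised to variables, so that their equality can be matched with `refl`.
    split-cell : ∀ {b b′} (q : Fin (classSize κ b)) (q′ : Fin (classSize κ b′)) →
      (Σ[ b ∈ Fin r ] Fin (blockSize b) ∋ (b , cell h q)) ≡ (b′ , cell h′ q′) →
      h ≡ h′ × (Σ[ b ∈ Fin r ] Fin (classSize κ b) ∋ (b , q)) ≡ (b′ , q′)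
    split-cell q q′ eq with ,-injectiveˡ eq
    ... | refl with cell-injective (,-injectiveʳ eq)
    ... | refl , refl = refl , refl
  ... | refl , eq′ with rank-injective κ eq′
  ... | refl = refl

  sum-blockSize : sum blockSize ≡ m * n
  sum-blockSize = trans (sym (*-distribˡ-sum n (classSize κ)))
                        (trans (cong (n *_) (sum-classSize κ)) (*-comm n m))

  blockLabelling : Labelling (m * n)
  blockLabelling = labelling (cast sum-blockSize ∘ slot ∘ remQuot n) (λ {x} {y} eq →
    trans (sym (combine-remQuot {m} n x))
      (trans (cong (uncurry combine) (slot-injective {remQuot n x} {remQuot n y} (cast-injective eq)))
             (combine-remQuot {m} n y)))
    where
    cast-injective : ∀ {i j} → cast sum-blockSize i ≡ cast sum-blockSize j → i ≡ j
    cast-injective {i} {j} eq = toℕ-injective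
      (trans (sym (toℕ-cast sum-blockSize i)) (trans (cong toℕ eq) (toℕ-cast sum-blockSize j)))

  label-blockLabelling : ∀ g h → label blockLabelling (combine g h) ≡ copyLabel g h
  label-blockLabelling g h = cong suc (begin
    toℕ (cast sum-blockSize (slot (remQuot n (combine g h))))  ≡⟨ toℕ-cast sum-blockSize (slot (remQuot n (combine g h))) ⟩
    toℕ (slot (remQuot n (combine g h)))                       ≡⟨ cong (toℕ ∘ slot) (remQuot-combine g h) ⟩
    toℕ (slot (g , h))                                         ≡⟨ toℕ-glue blockSize (κ g) _ ⟩
    start (κ g) + toℕ (cell h (rank κ g))                      ∎)
    where open ≡-Reasoning

  index : Fin n → ℕ
  index h = toℕ (Bijection.to f h)

  -- The weighted label sum of a copy when each colour has total weight `ρ`. A forward and a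
  -- backward position, counted from 1, add up to the class size plus one. The argument `y` is the
  -- weighted sum of the indices `f h − 1`.
  blockSum : Fin r → ℕ → ℕ → ℕ
  blockSum b ρ y = ρ * (start b + start b + suc (classSize κ b)) + classSize κ b * y

  -- The rank of `g` cancels because the colours carry equal weight. It is applied with `ω` an
  -- adjacency row, for the weight inside a copy, and with `ω` constant 1, for its total.
  sum-copyLabel : ∀ (ω : Fin n → ℕ) {ρ} →
    sum (λ h → ω h * 𝟙 (c h ≟ᵇ true)) ≡ ρ → sum (λ h → ω h * 𝟙 (c h ≟ᵇ false)) ≡ ρ →
    ∀ g → sum (λ h → ω h * copyLabel g h) ≡ blockSum (κ g) ρ (sum (λ h → ω h * index h))
  sum-copyLabel ω {ρ} sum₁ sum₂ g = begin
    sum (λ h → ω h * copyLabel g h)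
      ≡⟨ sum-cong-≗ pointwise ⟩
    sum (λ h → (P h * (o + suc (toℕ q)) + N h * (o + suc (toℕ (opposite q)))) + s * (ω h * index h))
      ≡⟨ ∑-distrib-+ (λ h → P h * (o + suc (toℕ q)) + N h * (o + suc (toℕ (opposite q)))) (λ h → s * (ω h * index h)) ⟩
    sum (λ h → P h * (o + suc (toℕ q)) + N h * (o + suc (toℕ (opposite q)))) + sum (λ h → s * (ω h * index h))
      ≡⟨ cong₂ _+_ (∑-distrib-+ (λ h → P h * (o + suc (toℕ q))) (λ h → N h * (o + suc (toℕ (opposite q)))))
                   (sym (*-distribˡ-sum s (λ h → ω h * index h))) ⟩
    sum (λ h → P h * (o + suc (toℕ q))) + sum (λ h → N h * (o + suc (toℕ (opposite q)))) + s * y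
      ≡⟨ cong (_+ s * y) (cong₂ _+_ (sym (*-distribʳ-sum (o + suc (toℕ q)) P))
                                    (sym (*-distribʳ-sum (o + suc (toℕ (opposite q))) N))) ⟩
    sum P * (o + suc (toℕ q)) + sum N * (o + suc (toℕ (opposite q))) + s * y
      ≡⟨ cong (_+ s * y) (cong₂ (λ a b → a * (o + suc (toℕ q)) + b * (o + suc (toℕ (opposite q)))) sum₁ sum₂) ⟩
    ρ * (o + suc (toℕ q)) + ρ * (o + suc (toℕ (opposite q))) + s * y
      ≡⟨ cong (_+ s * y) (gather ρ o (toℕ q) (suc (toℕ (opposite q)))) ⟩
    ρ * (o + o + suc (suc (toℕ (opposite q)) + toℕ q)) + s * y
      -- Here the rank disappears: `suc (toℕ (opposite q))` is `s ∸ toℕ q`.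
      ≡⟨ cong (λ z → ρ * (o + o + suc z) + s * y)
              (trans (cong (_+ toℕ q) (suc-toℕ-opposite q)) (m∸n+n≡m (<⇒≤ (toℕ<n q)))) ⟩
    ρ * (o + o + suc s) + s * y
      ∎
    where
    open ≡-Reasoning
    o = start (κ g)
    s = classSize κ (κ g)
    q = rank κ g
    y = sum (λ h → ω h * index h)
    P N : Fin n → ℕ
    P h = ω h * 𝟙 (c h ≟ᵇ true)
    N h = ω h * 𝟙 (c h ≟ᵇ false)

    gather : ∀ ρ o a b → ρ * (o + suc a) + ρ * (o + b) ≡ ρ * (o + o + suc (b + a))
    gather = solve-∀

    split₁ : ∀ w o s i a b → w * suc (o + (s * i + a)) ≡ w * 1 * (o + suc a) + w * 0 * b + s * (w * i)
    split₁ = solve-∀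

    split₂ : ∀ w o s i a b → w * suc (o + (s * i + a)) ≡ w * 0 * b + w * 1 * (o + suc a) + s * (w * i)
    split₂ = solve-∀

    pointwise : ∀ h → ω h * copyLabel g h ≡
      (P h * (o + suc (toℕ q)) + N h * (o + suc (toℕ (opposite q)))) + s * (ω h * index h)
    pointwise h rewrite toℕ-combine (Bijection.to f h) (if c h then q else opposite q) with c h
    ... | true  = split₁ (ω h) o s (index h) (toℕ q) (o + suc (toℕ (opposite q)))
    ... | false = split₂ (ω h) o s (index h) (toℕ (opposite q)) (o + suc (toℕ q))

-- Balanced colourings and nonneighbours in a regular graph

module _ (H : Graph n) {t} (regular : Regular (2 * t) H) where

  colourDegree≡half : ∀ {c} → IsNeighbourhoodBalanced H c → ∀ b u → colourDegree H c b u ≡ t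
  colourDegree≡half {c} balanced b u = trans (to-true b) (*-cancelˡ-≡ (colourDegree H c true u) t 2 (begin
    colourDegree H c true u + (colourDegree H c true u + 0)
      ≡⟨ cong (colourDegree H c true u +_) (trans (+-identityʳ _) (balanced u)) ⟩
    colourDegree H c true u + colourDegree H c false u
      ≡⟨ cong₂ _+_ (colourDegree-sum H c true u) (colourDegree-sum H c false u) ⟩
    sum (λ v → adj H u v * 𝟙 (c v ≟ᵇ true)) + sum (λ v → adj H u v * 𝟙 (c v ≟ᵇ false))
      ≡⟨ ∑-distrib-+ (λ v → adj H u v * 𝟙 (c v ≟ᵇ true)) (λ v → adj H u v * 𝟙 (c v ≟ᵇ false)) ⟨
    sum (λ v → adj H u v * 𝟙 (c v ≟ᵇ true) + adj H u v * 𝟙 (c v ≟ᵇ false))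
      ≡⟨ sum-cong-≗ (λ v → one-colour (adj H u v) (c v)) ⟩
    sum (adj H u)
      ≡⟨ degree-sum H u ⟨
    degree H u
      ≡⟨ regular u ⟩
    2 * t
      ∎))
    where
    open ≡-Reasoning
    to-true : ∀ b → colourDegree H c b u ≡ colourDegree H c true u
    to-true true  = refl
    to-true false = sym (balanced u)

    one-colour : ∀ a b → a * 𝟙 (b ≟ᵇ true) + a * 𝟙 (b ≟ᵇ false) ≡ a
    one-colour a true  = trans (cong₂ _+_ (*-identityʳ a) (*-zeroʳ a)) (+-identityʳ a)
    one-colour a false = cong₂ _+_ (*-zeroʳ a) (*-identityʳ a)

module _ (H : Graph n) where

  -- The diagonal is included: a vertex is its own nonneighbour, which makes every row sum positive.
  coadj : Fin n → Fin n → ℕ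
  coadj u v = 𝟙 (¬? (adj? H u v))

  sum-split-adj : ∀ u (Y : Fin n → ℕ) → sum (λ v → adj H u v * Y v) + sum (λ v → coadj u v * Y v) ≡ sum Y
  sum-split-adj u Y = trans (sym (∑-distrib-+ (λ v → adj H u v * Y v) (λ v → coadj u v * Y v)))
                            (sum-cong-≗ pointwise)
    where
    pointwise : ∀ v → adj H u v * Y v + coadj u v * Y v ≡ Y v
    pointwise v with adj? H u v
    ... | yes _ = trans (+-identityʳ _) (*-identityˡ (Y v))
    ... | no  _ = *-identityˡ (Y v)

  codegree-constant : ∀ {d} → Regular d H → ∀ u v → sum (coadj u) ≡ sum (coadj v)
  codegree-constant {d} regular u v = +-cancelˡ-≡ d _ _ (trans (total u) (sym (total v)))
    where
    total : ∀ u → d + sum (coadj u) ≡ sum {n} (const 1)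
    total u = begin
      d + sum (coadj u)
        ≡⟨ cong (_+ sum (coadj u)) (trans (sym (degree-sum H u)) (regular u)) ⟨
      sum (adj H u) + sum (coadj u)
        ≡⟨ cong₂ _+_ (sum-cong-≗ (λ v → *-identityʳ (adj H u v))) (sum-cong-≗ (λ v → *-identityʳ (coadj u v))) ⟨
      sum (λ v → adj H u v * 1) + sum (λ v → coadj u v * 1)
        ≡⟨ sum-split-adj u (const 1) ⟩
      sum {n} (const 1)
        ∎
      where open ≡-Reasoning

  codegree-positive : ∀ u → 0 < sum (coadj u)
  codegree-positive u = ≤-trans (≤-reflexive (sym (𝟙-true (¬? (adj? H u u)) (irreflexive H refl))))
                                (term≤sum (coadj u) u)

  -- The nonneighbours of h are as many as those of h′, and there is at least
  -- one of each.
  neighbour-sum-gap : ∀ {d} → Regular d H → ∀ {Y Y′ : Fin n → ℕ} {θ} →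
    (∀ x → Y x ≤ θ) → (∀ x → θ < Y′ x) → ∀ h h′ →
    sum (λ x → adj H h′ x * Y′ x) + sum Y < sum (λ x → adj H h x * Y x) + sum Y′
  neighbour-sum-gap regular {Y} {Y′} {θ} Y≤θ θ<Y′ h h′ = begin-strict
    N′ + sum Y       ≡⟨ cong (N′ +_) (sum-split-adj h Y) ⟨
    N′ + (N + C)     <⟨ +-monoʳ-< N′ (+-monoʳ-< N C<C′) ⟩
    N′ + (N + C′)    ≡⟨ swap N′ N C′ ⟩
    N + (N′ + C′)    ≡⟨ cong (N +_) (sum-split-adj h′ Y′) ⟩
    N + sum Y′       ∎
    where
    open ≤-Reasoning
    N  = sum (λ x → adj H h x * Y x)
    N′ = sum (λ x → adj H h′ x * Y′ x)
    C  = sum (λ x → coadj h x * Y x)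
    C′ = sum (λ x → coadj h′ x * Y′ x)

    swap : ∀ a b c → a + (b + c) ≡ b + (a + c)
    swap = solve-∀

    C<C′ : C < C′
    C<C′ = begin-strict
      C                              ≤⟨ sum-mono-≤ (λ x → *-monoʳ-≤ (coadj h x) (Y≤θ x)) ⟩
      sum (λ x → coadj h x * θ)      ≡⟨ *-distribʳ-sum θ (coadj h) ⟨
      sum (coadj h) * θ              ≡⟨ cong (_* θ) (codegree-constant regular h h′) ⟩
      sum (coadj h′) * θ             <⟨ *-monoʳ-< (sum (coadj h′)) {{>-nonZero (codegree-positive h′)}} (n<1+n θ) ⟩
      sum (coadj h′) * suc θ         ≡⟨ *-distribʳ-sum (suc θ) (coadj h′) ⟩
      sum (λ x → coadj h′ x * suc θ) ≤⟨ sum-mono-≤ (λ x → *-monoʳ-≤ (coadj h′ x) (θ<Y′ x)) ⟩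
      C′                             ∎

-- The block labelling of a lexicographic product

module LexicographicLabelling
  (Γ : Graph m) (H : Graph n) {t} (regular : Regular (2 * t) H) (¬isolated : NoIsolatedVertices H)
  (c : Fin n → Bool) (balanced : IsNeighbourhoodBalanced H c)
  (f : Labelling n) (f-antimagic : IsLocalDistanceAntimagic H f)
  (κ : Fin m → Fin r) (proper : ∀ u v → Adj Γ u v → κ u ≢ κ v)
  where

  open Blocks f c κ public

  -- The weight `ρ` is the number of vertices coloured `false`, which by `colour-classes-equal` is
  -- also the number coloured `true`.
  copySum : Fin r → ℕ
  copySum b = blockSum b (sum (λ h → 𝟙 (c h ≟ᵇ false))) (sum (λ h → 1 * index h))

  sum-copy : ∀ g → sum (copyLabel g) ≡ copySum (κ g)
  sum-copy g = trans (sum-cong-≗ (λ h → sym (*-identityˡ (copyLabel g h))))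
    (sum-copyLabel (const 1) (trans (unit true) (colour-classes-equal H ¬isolated regular c balanced)) (unit false) g)
    where
    unit : ∀ b → sum (λ h → 1 * 𝟙 (c h ≟ᵇ b)) ≡ sum (λ h → 𝟙 (c h ≟ᵇ b))
    unit b = sum-cong-≗ (λ h → *-identityˡ (𝟙 (c h ≟ᵇ b)))

  localSum : Fin r → Fin n → ℕ
  localSum b h = blockSum b t (sum (λ h′ → adj H h h′ * index h′))

  sum-local : ∀ g h → sum (λ h′ → adj H h h′ * copyLabel g h′) ≡ localSum (κ g) h
  sum-local g h = sum-copyLabel (adj H h) (half true) (half false) g
    where
    half : ∀ b → sum (λ h′ → adj H h h′ * 𝟙 (c h′ ≟ᵇ b)) ≡ t
    half b = trans (sym (colourDegree-sum H c b h)) (colourDegree≡half H regular balanced b h)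

  copySum-mono-≤ : ∀ g g′ → κ g Fin.< κ g′ → copySum (κ g) ≤ copySum (κ g′)
  copySum-mono-≤ g g′ κ< = subst₂ _≤_ (sum-copy g) (sum-copy g′)
    (sum-mono-≤ (λ h → ≤-trans (copyLabel≤ {g} κ< h) (<⇒≤ (copyLabel> g′ h))))

  weight-f : ∀ h → weight H f h ≡ 2 * t + sum (λ h′ → adj H h h′ * index h′)
  weight-f h = begin
    weight H f h
      ≡⟨ sum-neighbours H h (label f) ⟩
    sum (λ h′ → adj H h h′ * suc (index h′))
      ≡⟨ sum-cong-≗ (λ h′ → *-suc (adj H h h′) (index h′)) ⟩
    sum (λ h′ → adj H h h′ + adj H h h′ * index h′)
      ≡⟨ ∑-distrib-+ (adj H h) (λ h′ → adj H h h′ * index h′) ⟩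
    sum (adj H h) + sum (λ h′ → adj H h h′ * index h′)
      ≡⟨ cong (_+ sum (λ h′ → adj H h h′ * index h′)) (trans (sym (degree-sum H h)) (regular h)) ⟩
    2 * t + sum (λ h′ → adj H h h′ * index h′)
      ∎
    where open ≡-Reasoning

  localSum-distinguishes : ∀ g {h h′} → localSum (κ g) h ≡ localSum (κ g) h′ → weight H f h ≡ weight H f h′
  localSum-distinguishes g {h} {h′} eq = trans (weight-f h) (trans (cong (2 * t +_)
    -- The slope of `localSum` in the index sum is the class size, which is nonzero because
    -- `rank κ g` is an element of the class.
    (*-cancelˡ-≡ _ _ (classSize κ (κ g)) {{nonZeroIndex (rank κ g)}} (+-cancelˡ-≡ _ _ _ eq))) (sym (weight-f h′)))

  -- The value `ν b` is what the neighbouring copies contribute to a vertex of class `b`. The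
  -- antitone condition says that sums of copy totals over closed neighbourhoods do not increase
  -- along an edge towards the later class.
  module _
    (ν : Fin r → ℕ)
    (sum-neighbourCopies : ∀ g → sum (λ g′ → adj Γ g g′ * copySum (κ g′)) ≡ ν (κ g))
    (ν-antitone : ∀ u v → Adj Γ u v → κ u Fin.< κ v →
                  ν (κ v) + copySum (κ v) ≤ ν (κ u) + copySum (κ u))
    where

    weight-blockLabelling : ∀ g h → weight (Γ [ H ]) blockLabelling (combine g h) ≡ localSum (κ g) h + ν (κ g)
    weight-blockLabelling g h = trans (weight-[] Γ H blockLabelling copyLabel label-blockLabelling g h)
      (cong₂ _+_ (sum-local g h)
        (trans (sum-cong-≗ (λ g′ → cong (adj Γ g g′ *_) (sum-copy g′))) (sum-neighbourCopies g)))

    -- After adding both copy totals to each side, the claim is the sum of the strict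
    -- `neighbour-sum-gap` and the weak inequality `ν-antitone`.
    weight-decreasing : ∀ {u v} → Adj Γ u v → κ u Fin.< κ v → ∀ h h′ →
      localSum (κ v) h′ + ν (κ v) < localSum (κ u) h + ν (κ u)
    weight-decreasing {u} {v} e κ< h h′ = +-cancelʳ-< (copySum (κ u) + copySum (κ v)) _ _ (begin-strict
      (localSum (κ v) h′ + ν (κ v)) + (copySum (κ u) + copySum (κ v))
        ≡⟨ interchange (localSum (κ v) h′) (ν (κ v)) (copySum (κ u)) (copySum (κ v)) ⟩
      (localSum (κ v) h′ + copySum (κ u)) + (ν (κ v) + copySum (κ v))
        <⟨ +-mono-<-≤ gap (ν-antitone u v e κ<) ⟩
      (localSum (κ u) h + copySum (κ v)) + (ν (κ u) + copySum (κ u))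
        ≡⟨ interchange′ (localSum (κ u) h) (copySum (κ v)) (ν (κ u)) (copySum (κ u)) ⟩
      (localSum (κ u) h + ν (κ u)) + (copySum (κ u) + copySum (κ v))
        ∎)
      where
      open ≤-Reasoning
      interchange : ∀ a b x y → (a + b) + (x + y) ≡ (a + x) + (b + y)
      interchange = solve-∀
      interchange′ : ∀ a y b x → (a + y) + (b + x) ≡ (a + b) + (x + y)
      interchange′ = solve-∀
      gap : localSum (κ v) h′ + copySum (κ u) < localSum (κ u) h + copySum (κ v)
      gap = subst₂ _<_ (cong₂ _+_ (sum-local v h′) (sum-copy u)) (cong₂ _+_ (sum-local u h) (sum-copy v))
        (neighbour-sum-gap H regular (copyLabel≤ {u} κ<) (copyLabel> v) h h′)

    pair-antimagic : ∀ g h g′ h′ → ×-Lex _≡_ (Adj Γ) (Adj H) (g , h) (g′ , h′) →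
      localSum (κ g) h + ν (κ g) ≢ localSum (κ g′) h′ + ν (κ g′)
    pair-antimagic g h .g h′ (inj₂ (refl , e)) eq =
      f-antimagic h h′ e (localSum-distinguishes g (+-cancelʳ-≡ (ν (κ g)) _ _ eq))
    pair-antimagic g h g′ h′ (inj₁ e) with <-cmpᶠ (κ g) (κ g′)
    ... | tri< κ< _ _ = <⇒≢ (weight-decreasing e κ< h h′) ∘ sym
    ... | tri≈ _ κ≡ _ = contradiction κ≡ (proper g g′ e)
    ... | tri> _ _ κ> = <⇒≢ (weight-decreasing (symmetric Γ e) κ> h′ h)

    copyOf : Fin (m * n) → Fin m
    copyOf = proj₁ ∘ remQuot {m} n

    vertexOf : Fin (m * n) → Fin n
    vertexOf = proj₂ ∘ remQuot {m} n

    weight-at : ∀ x → weight (Γ [ H ]) blockLabelling x ≡ localSum (κ (copyOf x)) (vertexOf x) + ν (κ (copyOf x))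
    weight-at x = trans (cong (weight (Γ [ H ]) blockLabelling) (sym (combine-remQuot {m} n x)))
                        (weight-blockLabelling (copyOf x) (vertexOf x))

    blockLabelling-antimagic : IsLocalDistanceAntimagic (Γ [ H ]) blockLabelling
    blockLabelling-antimagic x y e eq =
      pair-antimagic (copyOf x) (vertexOf x) (copyOf y) (vertexOf y) e
        (trans (sym (weight-at x)) (trans eq (weight-at y)))

    numWeights-blockLabelling : numWeights (Γ [ H ]) blockLabelling ≤ r * numWeights H f
    -- Subtracting `2 * t` turns a weight under `f` back into the sum of zero-based indices. By
    -- `weight-f` nothing is truncated.
    numWeights-blockLabelling = image-bound (λ b w → blockSum b t (w ∸ 2 * t) + ν b)
      (weight (Γ [ H ]) blockLabelling) (weight H f)
      (λ x → κ (copyOf x) , vertexOf x ,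
        trans (weight-at x) (cong (λ y → blockSum (κ (copyOf x)) t y + ν (κ (copyOf x))) (localIndexSum (vertexOf x))))
      where
      localIndexSum : ∀ h → sum (λ h′ → adj H h h′ * index h′) ≡ weight H f h ∸ 2 * t
      localIndexSum h = sym (trans (cong (_∸ 2 * t) (weight-f h)) (m+n∸m≡n (2 * t) _))

-- The join with one vertex

sideClass : Bool → Fin 3
sideClass b = if b then 1F else 2F

-- The added vertex gets the first class, hence the smallest labels: its closed neighbourhood is the
-- whole join, so its closed sum is the largest.
joinClass : (Fin m → Bool) → Fin (suc m) → Fin 3
joinClass side zero    = 0F
joinClass side (suc u) = sideClass (side u)

module _ {G : Graph m} {side : Fin m → Bool} (crossing : ∀ u v → Adj G u v → side u ≢ side v) where

  sideClass-crossing : ∀ {u v} → Adj G u v → sideClass (side v) ≡ sideClass (not (side u))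
  sideClass-crossing {u} {v} e = cong sideClass (¬-not (crossing v u (symmetric G e)))

  joinClass-proper : ∀ u v → Adj (G +K₁) u v → joinClass side u ≢ joinClass side v
  joinClass-proper zero    (suc v) e eq with side v
  joinClass-proper zero    (suc v) e () | true
  joinClass-proper zero    (suc v) e () | false
  joinClass-proper (suc u) zero    e eq with side u
  joinClass-proper (suc u) zero    e () | true
  joinClass-proper (suc u) zero    e () | false
  joinClass-proper (suc u) (suc v) e eq with side u | side v | crossing u v e
  ... | true  | true  | t≢t = t≢t refl
  ... | false | false | f≢f = f≢f refl

  module JoinSums {k} (regular : Regular k G) (S : Fin 3 → ℕ) where

    degree-positive : ∀ {u v} → Adj G u v → 1 ≤ k
    degree-positive {u} {v} e = begin
      1              ≡⟨ 𝟙-true (adj? G u v) e ⟨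
      adj G u v      ≤⟨ term≤sum (adj G u) v ⟩
      sum (adj G u)  ≡⟨ degree-sum G u ⟨
      degree G u     ≡⟨ regular u ⟩
      k              ∎
      where open ≤-Reasoning

    sideSum : Bool → ℕ
    sideSum b = S 0F + k * S (sideClass (not b))

    ν : Fin 3 → ℕ
    ν 0F = sum (λ i → S (sideClass (side i)))
    ν 1F = sideSum true
    ν 2F = sideSum false

    ν-sideClass : ∀ b → ν (sideClass b) ≡ sideSum b
    ν-sideClass true  = refl
    ν-sideClass false = refl

    sum-across : ∀ u → sum (λ i → adj G u i * S (sideClass (side i))) ≡ k * S (sideClass (not (side u)))
    sum-across u = begin
      sum (λ i → adj G u i * S (sideClass (side i)))  ≡⟨ sum-cong-≗ pointwise ⟩
      sum (λ i → adj G u i * T)                       ≡⟨ *-distribʳ-sum T (adj G u) ⟨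
      sum (adj G u) * T                               ≡⟨ cong (_* T) (trans (sym (degree-sum G u)) (regular u)) ⟩
      k * T                                           ∎
      where
      open ≡-Reasoning
      T = S (sideClass (not (side u)))

      pointwise : ∀ i → adj G u i * S (sideClass (side i)) ≡ adj G u i * T
      pointwise i with adj? G u i
      ... | yes e = cong (λ b → 1 * S b) (sideClass-crossing e)
      ... | no  _ = refl

    sum-joinNeighbours : ∀ g → sum (λ g′ → adj (G +K₁) g g′ * S (joinClass side g′)) ≡ ν (joinClass side g)
    -- The term of the added vertex itself reduces to `0`.
    sum-joinNeighbours zero    = sum-cong-≗ (λ i → *-identityˡ (S (sideClass (side i))))
    sum-joinNeighbours (suc u) =
      trans (cong₂ _+_ (*-identityˡ (S 0F)) (sum-across u)) (sym (ν-sideClass (side u)))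

    -- The left side is the sum over the closed neighbourhood of `u` in `G`, where each vertex
    -- occurs at most once since `u` is not its own neighbour.
    closedSum≤total : ∀ u → k * S (sideClass (not (side u))) + S (sideClass (side u)) ≤ ν 0F
    closedSum≤total u = begin
      k * S (sideClass (not (side u))) + Y u
        ≡⟨ cong₂ _+_ (sum-across u) (sum-δ u Y) ⟨
      sum (λ i → adj G u i * Y i) + sum (λ i → 𝟙 (u ≟ᶠ i) * Y i)
        ≡⟨ ∑-distrib-+ (λ i → adj G u i * Y i) (λ i → 𝟙 (u ≟ᶠ i) * Y i) ⟨
      sum (λ i → adj G u i * Y i + 𝟙 (u ≟ᶠ i) * Y i)
        ≤⟨ sum-mono-≤ pointwise ⟩
      sum Y
        ∎
      where
      open ≤-Reasoning
      Y : Fin m → ℕ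
      Y i = S (sideClass (side i))

      pointwise : ∀ i → adj G u i * Y i + 𝟙 (u ≟ᶠ i) * Y i ≤ Y i
      pointwise i with adj? G u i | u ≟ᶠ i
      ... | yes e | yes refl = ⊥-elim (irreflexive G refl e)
      ... | yes _ | no  _    = ≤-reflexive (trans (+-identityʳ _) (*-identityˡ (Y i)))
      ... | no  _ | yes _    = ≤-reflexive (*-identityˡ (Y i))
      ... | no  _ | no  _    = z≤n

    -- From the added vertex to a side, both closed sums contain `S 0F` and `closedSum≤total`
    -- compares the rest. Between the sides, the larger total is multiplied by `k` in the closed sum
    -- of the lower class.
    ν-antitone : (∀ u v → joinClass side u Fin.< joinClass side v → S (joinClass side u) ≤ S (joinClass side v)) →
      ∀ u v → Adj (G +K₁) u v → joinClass side u Fin.< joinClass side v →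
      ν (joinClass side v) + S (joinClass side v) ≤ ν (joinClass side u) + S (joinClass side u)
    ν-antitone S-mono zero (suc v) _ _ = begin
      ν (sideClass (side v)) + S (sideClass (side v))
        ≡⟨ cong (_+ S (sideClass (side v))) (ν-sideClass (side v)) ⟩
      S 0F + k * S (sideClass (not (side v))) + S (sideClass (side v))
        ≡⟨ +-assoc (S 0F) _ _ ⟩
      S 0F + (k * S (sideClass (not (side v))) + S (sideClass (side v)))
        ≤⟨ +-monoʳ-≤ (S 0F) (closedSum≤total v) ⟩
      S 0F + ν 0F
        ≡⟨ +-comm (S 0F) (ν 0F) ⟩
      ν 0F + S 0F
        ∎
      where open ≤-Reasoning
    -- The proofs `κ<` and `S-mono` are abstracted together with the sides, so that their types
    -- reduce to concrete classes.
    ν-antitone S-mono (suc u) (suc v) e κ< with side u | side v | crossing u v e | κ< | S-mono (suc u) (suc v) κ<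
    ... | true  | true  | t≢t | _ | _ = contradiction refl t≢t
    ... | false | false | f≢f | _ | _ = contradiction refl f≢f
    ... | false | true  | _   | s≤s () | _
    ... | true  | false | _   | _ | S₁≤S₂ = exchange (degree-positive e) S₁≤S₂
      where
      -- With `1 ≤ j`, one `a` splits off on the left and one `b` on the right. Then `a + b` is
      -- common, and `j − 1` copies of `a` are compared with as many of `b`.
      exchange : ∀ {j a b} → 1 ≤ j → a ≤ b → S 0F + j * a + b ≤ S 0F + j * b + a
      exchange {suc j} {a} {b} _ a≤b = begin
        S 0F + suc j * a + b    ≡⟨ shuffle (S 0F) j a b ⟩
        S 0F + (j * a + (a + b)) ≤⟨ +-monoʳ-≤ (S 0F) (+-monoˡ-≤ (a + b) (*-monoʳ-≤ j a≤b)) ⟩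
        S 0F + (j * b + (a + b)) ≡⟨ shuffle′ (S 0F) j a b ⟩
        S 0F + suc j * b + a    ∎
        where
        open ≤-Reasoning
        shuffle : ∀ s j a b → s + suc j * a + b ≡ s + (j * a + (a + b))
        shuffle = solve-∀
        shuffle′ : ∀ s j a b → s + (j * b + (a + b)) ≡ s + suc j * b + a
        shuffle′ = solve-∀

theorem6p7 : ∀ (m n k t : ℕ) (G : Graph m) (H : Graph n) →
    NoIsolatedVertices G →
    NoIsolatedVertices H →
    Regular k G →
    Bipartite G →
    Regular (2 * t) H →
    AdmitsNeighbourhoodBalancedColouring H →
    AdmitsLocalDistanceAntimagic H →
    ∃[ c ] ∃[ c′ ] (Isχld H c × Isχld ((G +K₁) [ H ]) c′ × c′ ≤ 3 * c)
theorem6p7 m n k t G H _ ¬isolated G-regular (side , crossing) H-regular (col , balanced) (f₀ , f₀-antimagic)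
  with χld-upper-bound H f₀ f₀-antimagic
... | c , isχ , _ with Isχld.attained isχ
-- The block labelling is built from a labelling `f` that attains the minimum for `H`, and `refl`
-- identifies `c` with `numWeights H f`.
... | f , f-antimagic , refl =
  let c′ , isχ′ , c′≤ = χld-upper-bound ((G +K₁) [ H ]) blockLabelling
                          (blockLabelling-antimagic ν sum-joinNeighbours (ν-antitone copySum-mono-≤))
  in c , c′ , isχ , isχ′ ,
     ≤-trans c′≤ (numWeights-blockLabelling ν sum-joinNeighbours (ν-antitone copySum-mono-≤))
  where
  open LexicographicLabelling (G +K₁) H {t} H-regular ¬isolated col balanced f f-antimagic
    (joinClass side) (joinClass-proper crossing)
  open JoinSums crossing G-regular copySum
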